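{- Let $m,p,q,n,k$ be positive integers. Let $\mathcal{A}$ be the set of all $(+K_{q-1})$-graphs in $\widetilde{\mathcal{H}}((m-1)|_p; q; n-k)$. For each $H \in \mathcal{A}$, let $\mathcal{M}(H) = \{M_1,\dots,M_t\}$ be the family of all maximal $K_{q-1}$-free subsets of $V(H)$, and for every $k$-tuple $(M_{i_1},\dots,M_{i_k})$ with $1 \le i_1 \le \dots \le i_k \le t$ let $G(M_{i_1},\dots,M_{i_k})$ be the graph obtained from $H$ by adding $k$ new pairwise non-adjacent vertices $v_1,\dots,v_k$ with $N_G(v_j) = M_{i_j}$ for $j=1,\dots,k$. Let $\mathcal{B}$ be the set (up to isomorphism) of all graphs $G$ so obtained (over all $H\in\mathcal{A}$ and all such $k$-tuples) which satisfy $\omega(G+e) = q$ for every non-edge $e$ of $G$ and which belong to $\widetilde{\mathcal{H}}(m|_p; q; n)$. Then $\mathcal{B}$ is equal (up to isomorphism) to the set of all maximal graphs in $\widetilde{\mathcal{H}}(m|_p; q; n)$ with independence number at least $k$.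
   Context: All graphs are finite, simple and undirected; $\omega(G)$ denotes the clique number, $N_G(v)$ the set of neighbors of $v$, $G+e$ the graph obtained by adding a non-edge $e$. For positive integers $a_1,\dots,a_s$, write $G \overset{v}{\rightarrow} (a_1,\dots,a_s)$ if for every coloring of the vertices of $G$ in $s$ colors there is an $i$ such that $G$ contains an $a_i$-clique all of whose vertices have color $i$. Write $G \overset{v}{\rightarrow} m|_p$ if $G \overset{v}{\rightarrow} (a_1,\dots,a_s)$ for all positive integers $a_1,\dots,a_s$ ($s$ not fixed) with $\sum_{i=1}^s (a_i-1)+1 = m$ and $\max_i a_i \le p$. Let $\widetilde{\mathcal{H}}(m|_p; q) = \{G : G \overset{v}{\rightarrow} m|_p,\ \omega(G) < q\}$ and $\widetilde{\mathcal{H}}(m|_p; q; n)$ the set of graphs in it with exactly $n$ vertices. A graph $G$ is a maximal graph in $\widetilde{\mathcal{H}}(m|_p; q; n)$ if $G \in \widetilde{\mathcal{H}}(m|_p; q; n)$ but $G+e \notin \widetilde{\mathcal{H}}(m|_p; q; n)$ for every non-edge $e$. A graph $G$ is a $(+K_t)$-graph if for every non-edge $e$ of $G$, $G+e$ contains a new $t$-clique. A subset $S \subseteq V(H)$ is a maximal $K_{q-1}$-free subset if $H[S]$ contains no $(q-1)$-clique and $S$ is inclusion-maximal with this property.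
   Formalization: Excluded are degenerate parameters where the claim fails because 𝒜 is empty while an edgeless graph is maximal: q=2 with m=1 or p=1 and n≥k+2; and m=2, p=1, n=k with q=2 or (n=1, q≥2). -}

module Defs where

open import Data.Empty using (⊥)
open import Data.Fin.Base as Fin using (Fin; splitAt)
open import Data.Fin.Properties as Fin using (all?)
open import Data.Fin.Subset using (Subset; inside; outside; _∈_; _⊆_; _⊂_; ∣_∣)
open import Data.Fin.Subset.Properties using (_∈?_; _⊆?_; _⊂?_; anySubset?)
open import Data.List.Base as List using (List; length; filter; _++_)
open import Data.List.Extrema.Nat using (max)
open import Data.Nat.Base using (ℕ; zero; suc; pred; _+_; _∸_; _≤_; _<_)
open import Data.Nat.Properties as ℕ using ()
open import Data.Product.Base using (Σ; ∃; _×_; _,_)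
open import Data.Sum.Base using (_⊎_; inj₁; inj₂)
open import Data.Vec.Base as Vec using (Vec; []; _∷_)
open import Function.Base using (_∘_)
open import Function.Bundles using (_⇔_; _↔_; Inverse)
open import Level using (0ℓ; _⊔_) renaming (suc to lsuc)
open import Relation.Binary.Core using (Rel; _Preserves_⟶_)
open import Relation.Binary.Definitions using (Decidable; Symmetric; Irreflexive)
open import Relation.Binary.PropositionalEquality.Core using (_≡_; _≢_; refl; sym)
open import Relation.Nullary.Decidable using (no; ¬?; _×-dec_; _⊎-dec_; _→-dec_)
open import Relation.Nullary.Negation using (¬_)
open import Relation.Unary as U using (Pred)

record Graph : Set₁ where
  field
    order  : ℕ
    Adj    : Rel (Fin order) 0ℓ
    adj?   : Decidable Adj
    symm   : Symmetric Adj
    irrefl : Irreflexive _≡_ Adj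

open Graph public

V : Graph → Set
V G = Fin (order G)

record _≅_ (G H : Graph) : Set where
  field
    bijection : V G ↔ V H
    preserves : ∀ u v → Adj G u v ⇔ Adj H (Inverse.to bijection u) (Inverse.to bijection v)

-- Equality up to isomorphism of two sets of graphs.
_≐ᴵ_ : ∀ {a b} → Pred Graph a → Pred Graph b → Set (lsuc 0ℓ ⊔ a ⊔ b)
P ≐ᴵ Q = (∀ G → P G → Σ Graph λ G′ → Q G′ × G ≅ G′)
       × (∀ G → Q G → Σ Graph λ G′ → P G′ × G ≅ G′)

NonEdge : (G : Graph) → Rel (V G) 0ℓ
NonEdge G u v = u ≢ v × ¬ Adj G u v

_+ₑ_ : (G : Graph) {u v : V G} → NonEdge G u v → Graph
_+ₑ_ G {u} {v} (u≢v , _) = record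
  { order  = order G
  ; Adj    = λ x y → Adj G x y ⊎ ((x ≡ u × y ≡ v) ⊎ (x ≡ v × y ≡ u))
  ; adj?   = λ x y → adj? G x y
               ⊎-dec ((x Fin.≟ u ×-dec y Fin.≟ v) ⊎-dec (x Fin.≟ v ×-dec y Fin.≟ u))
  ; symm   = λ { (inj₁ a)                 → inj₁ (symm G a)
               ; (inj₂ (inj₁ (x≡u , y≡v))) → inj₂ (inj₂ (y≡v , x≡u))
               ; (inj₂ (inj₂ (x≡v , y≡u))) → inj₂ (inj₁ (y≡u , x≡v)) }
  ; irrefl = λ { refl (inj₁ a)                   → irrefl G refl a
               ; refl (inj₂ (inj₁ (refl , x≡v))) → u≢v x≡v
               ; refl (inj₂ (inj₂ (refl , x≡u))) → u≢v (sym x≡u) }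
  }

subsets : ∀ n → List (Subset n)
subsets zero    = List.[ [] ]
subsets (suc n) = List.map (inside ∷_) (subsets n) ++ List.map (outside ∷_) (subsets n)

-- The default value 0 of the maximum is harmless below: the empty set is
-- both a clique and an independent set.
maxCard : ∀ {n} {P : Pred (Subset n) 0ℓ} → U.Decidable P → ℕ
maxCard {n} P? = max 0 (List.map ∣_∣ (filter P? (subsets n)))

Clique : (G : Graph) → Pred (Subset (order G)) 0ℓ
Clique G S = ∀ u v → u ∈ S → v ∈ S → u ≢ v → Adj G u v

Independent : (G : Graph) → Pred (Subset (order G)) 0ℓ
Independent G S = ∀ u v → u ∈ S → v ∈ S → ¬ Adj G u v

clique? : (G : Graph) → U.Decidable (Clique G)
clique? G S = all? λ u → all? λ v →
  u ∈? S →-dec v ∈? S →-dec ¬? (u Fin.≟ v) →-dec adj? G u v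

independent? : (G : Graph) → U.Decidable (Independent G)
independent? G S = all? λ u → all? λ v →
  u ∈? S →-dec v ∈? S →-dec ¬? (adj? G u v)

ω : Graph → ℕ
ω G = maxCard (clique? G)

α : Graph → ℕ
α G = maxCard (independent? G)

CliqueOfSize : (G : Graph) → ℕ → Pred (Subset (order G)) 0ℓ
CliqueOfSize G t S = Clique G S × ∣ S ∣ ≡ t

cliqueOfSize? : (G : Graph) (t : ℕ) → U.Decidable (CliqueOfSize G t)
cliqueOfSize? G t S = clique? G S ×-dec ∣ S ∣ ℕ.≟ t

infix 4 _⟶ᵛ_ _⟶ᵛ_∣_

_⟶ᵛ_ : (G : Graph) {s : ℕ} → Vec ℕ s → Set
_⟶ᵛ_ G {s} a = (colour : V G → Fin s) →
  ∃ λ i → ∃ λ S → CliqueOfSize G (Vec.lookup a i) S × (∀ v → v ∈ S → colour v ≡ i)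

-- For m = 0 there is no admissible tuple, so the condition is vacuous.
_⟶ᵛ_∣_ : Graph → ℕ → ℕ → Set
G ⟶ᵛ m ∣ p = ∀ {s} (a : Vec ℕ (suc s)) →
  (∀ i → 1 ≤ Vec.lookup a i) →
  Vec.sum (Vec.map pred a) + 1 ≡ m →
  (∀ i → Vec.lookup a i ≤ p) →
  G ⟶ᵛ a

ℋ̃ : (m p q : ℕ) → Pred Graph 0ℓ
ℋ̃ m p q G = G ⟶ᵛ m ∣ p × ω G < q

ℋ̃ₙ : (m p q n : ℕ) → Pred Graph 0ℓ
ℋ̃ₙ m p q n G = ℋ̃ m p q G × order G ≡ n

Maximal : (m p q n : ℕ) → Pred Graph 0ℓ
Maximal m p q n G = ℋ̃ₙ m p q n G
                  × (∀ {u v} (e : NonEdge G u v) → ¬ ℋ̃ₙ m p q n (G +ₑ e))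

PlusK : ℕ → Pred Graph 0ℓ
PlusK t G = ∀ {u v} (e : NonEdge G u v) →
  ∃ λ S → CliqueOfSize (G +ₑ e) t S × ¬ CliqueOfSize G t S

KFree : (t : ℕ) (H : Graph) → Pred (Subset (order H)) 0ℓ
KFree t H S = ¬ ∃ λ T → T ⊆ S × CliqueOfSize H t T

MaximalKFree : (t : ℕ) (H : Graph) → Pred (Subset (order H)) 0ℓ
MaximalKFree t H S = KFree t H S × ¬ ∃ λ S′ → S ⊂ S′ × KFree t H S′

kFree? : (t : ℕ) (H : Graph) → U.Decidable (KFree t H)
kFree? t H S = ¬? (anySubset? λ T → T ⊆? S ×-dec cliqueOfSize? H t T)

maximalKFree? : (t : ℕ) (H : Graph) → U.Decidable (MaximalKFree t H)
maximalKFree? t H S =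
  kFree? t H S ×-dec ¬? (anySubset? λ S′ → S ⊂? S′ ×-dec kFree? t H S′)

-- The enumeration M₁, …, M_t of the maximal K_{q-1}-free subsets of V(H).
ℳ : (q : ℕ) (H : Graph) → List (Subset (order H))
ℳ q H = filter (maximalKFree? (q ∸ 1) H) (subsets (order H))

-- H together with k new pairwise non-adjacent vertices, the j-th of which has
-- neighbourhood N j; in Fin (order H + k) the vertices of H come first.
extend : (H : Graph) (k : ℕ) → (Fin k → Subset (order H)) → Graph
extend H k N = record
  { order  = order H + k
  ; Adj    = λ x y → A (splitAt (order H) x) (splitAt (order H) y)
  ; adj?   = λ x y → A? (splitAt (order H) x) (splitAt (order H) y)
  ; symm   = λ {x} {y} → A-sym (splitAt (order H) x) (splitAt (order H) y)
  ; irrefl = λ { {x} refl → A-irrefl (splitAt (order H) x) }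
  }
  where
  A : Rel (V H ⊎ Fin k) 0ℓ
  A (inj₁ u) (inj₁ v) = Adj H u v
  A (inj₁ u) (inj₂ j) = u ∈ N j
  A (inj₂ j) (inj₁ v) = v ∈ N j
  A (inj₂ _) (inj₂ _) = ⊥

  A? : Decidable A
  A? (inj₁ u) (inj₁ v) = adj? H u v
  A? (inj₁ u) (inj₂ j) = u ∈? N j
  A? (inj₂ j) (inj₁ v) = v ∈? N j
  A? (inj₂ _) (inj₂ _) = no λ ()

  A-sym : ∀ x y → A x y → A y x
  A-sym (inj₁ u) (inj₁ v) a = symm H a
  A-sym (inj₁ u) (inj₂ j) a = a
  A-sym (inj₂ j) (inj₁ v) a = a

  A-irrefl : ∀ x → ¬ A x x
  A-irrefl (inj₁ u) a = irrefl H refl a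

-- If n < k, truncated subtraction admits the null graph here; the graphs
-- obtained from it have k ≠ n vertices, so none of them lies in ℬ.
𝒜 : (m p q n k : ℕ) → Pred Graph 0ℓ
𝒜 m p q n k H = ℋ̃ₙ (m ∸ 1) p q (n ∸ k) H × PlusK (q ∸ 1) H

data Obtained (m p q n k : ℕ) : Pred Graph (lsuc 0ℓ) where
  obtain : (H : Graph) → 𝒜 m p q n k H →
           (i : Fin k → Fin (length (ℳ q H))) →
           i Preserves Fin._≤_ ⟶ Fin._≤_ →
           Obtained m p q n k (extend H k (List.lookup (ℳ q H) ∘ i))

ℬ : (m p q n k : ℕ) → Pred Graph (lsuc 0ℓ)
ℬ m p q n k G = Obtained m p q n k G
              × (∀ {u v} (e : NonEdge G u v) → ω (G +ₑ e) ≡ q)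
              × ℋ̃ₙ m p q n G

-- The degenerate parameters for which the two sets differ.
--  * edgeless: the edgeless graph on n vertices is maximal, but 𝒜 is empty,
--    since adding an edge never creates a new 1-clique and n ∸ k ≥ 2.
--  * null: the condition 2|₁ is vacuous, so the edgeless graph on n = k
--    vertices is maximal, but 𝒜 is empty, since the null graph does not
--    satisfy 1|₁ (it has no 1-clique).
data Exceptional (m p q n k : ℕ) : Set where
  edgeless : q ≡ 2 → m ≡ 1 ⊎ p ≡ 1 → 2 + k ≤ n → Exceptional m p q n k
  null     : m ≡ 2 → p ≡ 1 → n ≡ k → q ≡ 2 ⊎ (n ≡ 1 × 2 ≤ q) → Exceptional m p q n k

{-# OPTIONS --safe #-}

-- Adding an edge to G preserves G ⟶ m|_p, so maximality says exactly that
-- every added edge creates a q-clique.  Split a maximal graph G along an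
-- independent set A of size k, with core H = G − A.  A colouring of H, with A
-- as one more colour class, shows H ⟶ (m − 1)|_p, since A contains no
-- 2-clique.  The q-clique created by an edge inside H meets A in at most one
-- vertex, which makes H a (+K_{q−1})-graph; the one created by an edge from
-- v ∈ A to w ∈ V(H) lies in {v, w} ∪ N(v), which makes N(v) a maximal
-- K_{q−1}-free set.  Reordering A makes the indices of these sets increase.
module Submission where

open import Defs
open import Data.Nat.Base using (ℕ; _≥_)
open import Data.Product.Base using (_×_)
open import Relation.Nullary.Negation using (¬_)

open import Data.Bool.Base using (true)
open import Data.Empty using (⊥-elim)
open import Data.Fin.Base as Fin using (Fin; zero; suc; _↑ˡ_; _↑ʳ_; splitAt; join; punchIn; punchOut; inject≤)
open import Data.Fin.Permutation using (Permutation′; _⟨$⟩ʳ_; id; insert; insert-punchIn; ↔⇒≡)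
open import Data.Fin.Properties as Fin using (any?; splitAt-↑ˡ; splitAt-↑ʳ; splitAt-join; join-splitAt)
open import Data.Fin.Subset using (Subset; inside; outside; _∈_; _∉_; _⊆_; ∣_∣; ∁) renaming (⊥ to ∅)
open import Data.Fin.Subset.Properties using (∉⊥; ∣⊥∣≡0)
open import Data.List.Base as List using (length; filter)
open import Data.List.Extrema.Nat using (argmax-sel; v≤max⁺)
open import Data.List.Membership.Propositional using () renaming (_∈_ to _∈ₗ_)
open import Data.List.Membership.Propositional.Properties using (∈-map⁺; ∈-++⁺ˡ; ∈-++⁺ʳ; ∈-filter⁺; ∈-map∘filter⁺; ∈-map∘filter⁻)
open import Data.List.Relation.Unary.Any as Any using (here)
open import Data.List.Relation.Unary.Any.Properties using (lookup-index)
open import Data.Nat.Base using (zero; suc; pred; _+_; _∸_; _≤_; _<_; z≤n; s≤s)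
open import Data.Nat.Properties as ℕ using (≤-refl; ≤-trans; ≤-reflexive; ≤-antisym; <⇒≱; ≰⇒>; _≤?_)
open import Data.Product.Base using (Σ; ∃; ∃₂; _,_; proj₁; proj₂)
open import Data.Sum.Base as Sum using (_⊎_; inj₁; inj₂; [_,_])
open import Data.Vec.Base as Vec using (Vec; []; _∷_; _[_]≔_; here; there; lookup; replicate)
open import Data.Vec.Properties using ([]≔-updates; lookup-replicate; lookup∘tabulate; []=⇒lookup; lookup⇒[]=)
open import Function.Base using (_∘_; const)
open import Function.Bundles using (_⇔_; _↔_; Inverse; Equivalence; mk⇔; mk↔ₛ′)
open import Function.Definitions using (Injective)
open import Level using (0ℓ)
open import Relation.Binary.Core using (_Preserves_⟶_)
open import Relation.Binary.PropositionalEquality using (_≡_; _≢_; refl; sym; trans; cong; subst; subst₂)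
open import Relation.Nullary.Decidable using (yes; no; does; dec-true)
open import Relation.Nullary.Negation using (contradiction)
open import Relation.Unary as U using (Pred)

-- Finite sets

Fin-≢⇒2≤ : ∀ {n} {u v : Fin n} → u ≢ v → 2 ≤ n
Fin-≢⇒2≤ {suc zero}    {zero} {zero} u≢v = contradiction refl u≢v
Fin-≢⇒2≤ {suc (suc n)}               _   = s≤s (s≤s z≤n)

empty-or-inhabited : ∀ n → n ≡ 0 ⊎ Fin n
empty-or-inhabited zero    = inj₁ refl
empty-or-inhabited (suc n) = inj₂ zero

singleton-or-two-distinct : ∀ {n} → 1 ≤ n → n ≡ 1 ⊎ ∃₂ λ (u v : Fin n) → u ≢ v
singleton-or-two-distinct {suc zero}    _ = inj₁ refl
singleton-or-two-distinct {suc (suc n)} _ = inj₂ (zero , suc zero , λ ())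

-- Applied to the positions `i`, `j` of the ends of an added edge in a clique of `2 + q` vertices;
-- `q ≢ 0` provides the third vertex.
other-than-two : ∀ {q} → q ≢ 0 → (i j : Fin (2 + q)) → ∃ λ x → i ≢ x × j ≢ x
other-than-two {zero}  q≢0 _             _             = contradiction refl q≢0
other-than-two {suc q} _   zero          zero          = suc zero , (λ ()) , λ ()
other-than-two {suc q} _   zero          (suc zero)    = suc (suc zero) , (λ ()) , λ ()
other-than-two {suc q} _   zero          (suc (suc j)) = suc zero , (λ ()) , λ ()
other-than-two {suc q} _   (suc zero)    zero          = suc (suc zero) , (λ ()) , λ ()
other-than-two {suc q} _   (suc (suc i)) zero          = suc zero , (λ ()) , λ ()
other-than-two {suc q} _   (suc i)       (suc j)       = zero , (λ ()) , λ ()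

argmin-Fin : ∀ {k t} (g : Fin (suc k) → Fin t) → ∃ λ x → ∀ y → g x Fin.≤ g y
argmin-Fin {zero}  g = zero , λ { zero → ≤-refl }
argmin-Fin {suc k} g with argmin-Fin (g ∘ suc)
... | x , min with g zero Fin.≤? g (suc x)
...   | yes g0≤ = zero , λ { zero → ≤-refl ; (suc y) → ≤-trans g0≤ (min y) }
...   | no  g0≰ = suc x , λ { zero → ℕ.<⇒≤ (≰⇒> g0≰) ; (suc y) → min y }

-- Selection sort: the position `x` of a least value goes first, and the values at the other
-- positions, enumerated by `punchIn x`, are sorted recursively.
sorting-permutation : ∀ {k t} (g : Fin k → Fin t) →
  ∃ λ (π : Permutation′ k) → (λ j → g (π ⟨$⟩ʳ j)) Preserves Fin._≤_ ⟶ Fin._≤_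
sorting-permutation {zero}  g = id , λ { {()} }
sorting-permutation {suc k} g with argmin-Fin g
... | x , min with sorting-permutation (g ∘ punchIn x)
...   | π , mono = ρ , λ {i} {j} → monotone i j
  where
  ρ = insert zero x π
  monotone : ∀ i j → i Fin.≤ j → g (ρ ⟨$⟩ʳ i) Fin.≤ g (ρ ⟨$⟩ʳ j)
  monotone zero    j       _         = min (ρ ⟨$⟩ʳ j)
  monotone (suc i) (suc j) (s≤s i≤j)
    rewrite insert-punchIn zero x π i | insert-punchIn zero x π j = mono i≤j

element : ∀ {n} (S : Subset n) → Fin ∣ S ∣ → Fin n
element (inside  ∷ S) zero    = zero
element (inside  ∷ S) (suc i) = suc (element S i)
element (outside ∷ S) i       = suc (element S i)

element-∈ : ∀ {n} (S : Subset n) i → element S i ∈ S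
element-∈ (inside  ∷ S) zero    = here
element-∈ (inside  ∷ S) (suc i) = there (element-∈ S i)
element-∈ (outside ∷ S) i       = there (element-∈ S i)

element-injective : ∀ {n} (S : Subset n) → Injective _≡_ _≡_ (element S)
element-injective (inside  ∷ S) {zero}  {zero}  eq = refl
element-injective (inside  ∷ S) {suc i} {suc j} eq =
  cong suc (element-injective S (Fin.suc-injective eq))
element-injective (outside ∷ S) eq = element-injective S (Fin.suc-injective eq)

-- The inverse is by construction `element` on each summand, so adjacency in the core that
-- `decompose` builds agrees with adjacency in `G` by computation.
partition : ∀ {n} (S : Subset n) → Fin n ↔ (Fin ∣ ∁ S ∣ ⊎ Fin ∣ S ∣)
partition S = mk↔ₛ′ (to S) (from S) (to∘from S) (from∘to S)
  where
  to : ∀ {n} (S : Subset n) → Fin n → Fin ∣ ∁ S ∣ ⊎ Fin ∣ S ∣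
  to (inside  ∷ S) zero    = inj₂ zero
  to (inside  ∷ S) (suc x) = Sum.map₂ suc (to S x)
  to (outside ∷ S) zero    = inj₁ zero
  to (outside ∷ S) (suc x) = Sum.map₁ suc (to S x)

  from : ∀ {n} (S : Subset n) → Fin ∣ ∁ S ∣ ⊎ Fin ∣ S ∣ → Fin n
  from S = [ element (∁ S) , element S ]

  to∘from : ∀ {n} (S : Subset n) x → to S (from S x) ≡ x
  to∘from (inside  ∷ S) (inj₁ i)       = cong (Sum.map₂ suc) (to∘from S (inj₁ i))
  to∘from (inside  ∷ S) (inj₂ zero)    = refl
  to∘from (inside  ∷ S) (inj₂ (suc i)) = cong (Sum.map₂ suc) (to∘from S (inj₂ i))
  to∘from (outside ∷ S) (inj₁ zero)    = refl
  to∘from (outside ∷ S) (inj₁ (suc i)) = cong (Sum.map₁ suc) (to∘from S (inj₁ i))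
  to∘from (outside ∷ S) (inj₂ i)       = cong (Sum.map₁ suc) (to∘from S (inj₂ i))

  from∘to : ∀ {n} (S : Subset n) x → from S (to S x) ≡ x
  from∘to (inside  ∷ S) zero    = refl
  from∘to (inside  ∷ S) (suc x) with to S x | from∘to S x
  ... | inj₁ i | eq = cong suc eq
  ... | inj₂ i | eq = cong suc eq
  from∘to (outside ∷ S) zero    = refl
  from∘to (outside ∷ S) (suc x) with to S x | from∘to S x
  ... | inj₁ i | eq = cong suc eq
  ... | inj₂ i | eq = cong suc eq

image : ∀ {t n} → (Fin t → Fin n) → Subset n
image {zero}  f = ∅
image {suc t} f = image (f ∘ suc) [ f zero ]≔ inside

∈-insert⁺ : ∀ {n} {S : Subset n} x {v} → v ∈ S → v ∈ S [ x ]≔ inside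
∈-insert⁺ zero    here        = here
∈-insert⁺ (suc x) here        = here
∈-insert⁺ zero    (there v∈S) = there v∈S
∈-insert⁺ (suc x) (there v∈S) = there (∈-insert⁺ x v∈S)

∈-insert⁻ : ∀ {n} (S : Subset n) x {v} → v ∈ S [ x ]≔ inside → x ≡ v ⊎ v ∈ S
∈-insert⁻ (s ∷ S) zero    here      = inj₁ refl
∈-insert⁻ (s ∷ S) zero    (there h) = inj₂ (there h)
∈-insert⁻ (s ∷ S) (suc x) here      = inj₂ here
∈-insert⁻ (s ∷ S) (suc x) (there h) = Sum.map (cong suc) there (∈-insert⁻ S x h)

∣insert∣ : ∀ {n} (S : Subset n) x → x ∉ S → ∣ S [ x ]≔ inside ∣ ≡ suc ∣ S ∣
∣insert∣ (inside  ∷ S) zero    x∉S = contradiction here x∉S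
∣insert∣ (outside ∷ S) zero    x∉S = refl
∣insert∣ (inside  ∷ S) (suc x) x∉S = cong suc (∣insert∣ S x (x∉S ∘ there))
∣insert∣ (outside ∷ S) (suc x) x∉S = ∣insert∣ S x (x∉S ∘ there)

∈-image⁺ : ∀ {t n} (f : Fin t → Fin n) i → f i ∈ image f
∈-image⁺ f zero    = []≔-updates (image (f ∘ suc)) (f zero)
∈-image⁺ f (suc i) = ∈-insert⁺ (f zero) (∈-image⁺ (f ∘ suc) i)

∈-image⁻ : ∀ {t n} (f : Fin t → Fin n) {v} → v ∈ image f → ∃ λ i → f i ≡ v
∈-image⁻ {zero}  f v∈ = contradiction v∈ ∉⊥
∈-image⁻ {suc t} f v∈ with ∈-insert⁻ (image (f ∘ suc)) (f zero) v∈
... | inj₁ eq = zero , eq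
... | inj₂ h  with ∈-image⁻ (f ∘ suc) h
...   | i , eq = suc i , eq

image-⊆ : ∀ {t n} (f : Fin t → Fin n) {S : Subset n} → (∀ i → f i ∈ S) → image f ⊆ S
image-⊆ f f∈S v∈ with ∈-image⁻ f v∈
... | i , refl = f∈S i

∣image∣ : ∀ {t n} (f : Fin t → Fin n) → Injective _≡_ _≡_ f → ∣ image f ∣ ≡ t
∣image∣ {zero}  {n} f inj = ∣⊥∣≡0 n
∣image∣ {suc t} f inj = trans
  (∣insert∣ (image (f ∘ suc)) (f zero)
    λ f0∈ → contradiction (inj (proj₂ (∈-image⁻ (f ∘ suc) f0∈))) λ ())
  (cong suc (∣image∣ (f ∘ suc) (Fin.suc-injective ∘ inj)))

-- Maximal cardinality of subsets

∈-subsets : ∀ {n} (S : Subset n) → S ∈ₗ subsets n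
∈-subsets []            = here refl
∈-subsets (inside  ∷ S) = ∈-++⁺ˡ (∈-map⁺ (inside ∷_) (∈-subsets S))
∈-subsets (outside ∷ S) = ∈-++⁺ʳ _ (∈-map⁺ (outside ∷_) (∈-subsets S))

∣S∣≤maxCard : ∀ {n} {P : Pred (Subset n) 0ℓ} (P? : U.Decidable P) {S} →
  P S → ∣ S ∣ ≤ maxCard P?
∣S∣≤maxCard P? {S} PS = v≤max⁺ 0 _
  (inj₂ (Any.map ≤-reflexive (∈-map∘filter⁺ ∣_∣ P? (S , ∈-subsets S , refl , PS))))

maxCard-attained : ∀ {n} {P : Pred (Subset n) 0ℓ} (P? : U.Decidable P) →
  P ∅ → ∃ λ S → P S × ∣ S ∣ ≡ maxCard P?
maxCard-attained {n} P? P∅ with argmax-sel (λ x → x) 0 (List.map ∣_∣ (filter P? (subsets n)))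
-- Here the maximum is the default value 0, which the empty set attains.
... | inj₁ eq = ∅ , P∅ , trans (∣⊥∣≡0 n) (sym eq)
... | inj₂ h with ∈-map∘filter⁻ ∣_∣ P? {xs = subsets n} h
...   | S , _ , eq , PS = S , PS , sym eq

-- Cliques as embeddings

-- A clique is indexed by `Fin t`, so that adding or dropping a vertex is a reindexing. Since `Adj`
-- is irreflexive, `adjacent` makes `vertex` injective, and any map preserving adjacency carries
-- cliques to cliques of the same size.
record K (t : ℕ) (G : Graph) : Set where
  constructor clique
  field
    vertex   : Fin t → V G
    adjacent : ∀ {i j} → i ≢ j → Adj G (vertex i) (vertex j)

  vertex-injective : Injective _≡_ _≡_ vertex
  vertex-injective {i} {j} eq with i Fin.≟ j
  ... | yes i≡j = i≡j
  ... | no  i≢j = contradiction (adjacent i≢j) (irrefl G eq)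

open K

K-map : ∀ {t} {G H : Graph} (f : V G → V H) →
  (∀ {u v} → Adj G u v → Adj H (f u) (f v)) → K t G → K t H
K-map f hom (clique c adj) = clique (f ∘ c) (hom ∘ adj)

K-single : ∀ {G : Graph} → V G → K 1 G
K-single v = clique (const v) λ { {zero} {zero} 0≢0 → contradiction refl 0≢0 }

K-≤ : ∀ {s t} {G : Graph} → s ≤ t → K t G → K s G
K-≤ s≤t (clique c adj) = clique (λ i → c (inject≤ i s≤t))
  λ i≢j → adj (i≢j ∘ Fin.inject≤-injective s≤t s≤t _ _)

K-remove : ∀ {t} {G : Graph} → K (suc t) G → Fin (suc t) → K t G
K-remove (clique c adj) x = clique (c ∘ punchIn x)
  λ i≢j → adj (i≢j ∘ Fin.punchIn-injective x _ _)

K-cons : ∀ {t} {G : Graph} v (c : K t G) → (∀ i → Adj G v (vertex c i)) → K (suc t) G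
K-cons {G = G} v (clique c adj) vc = clique (λ { zero → v ; (suc i) → c i }) λ
  { {zero}  {zero}  0≢0 → contradiction refl 0≢0
  ; {zero}  {suc j} _   → vc j
  ; {suc i} {zero}  _   → symm G (vc i)
  ; {suc i} {suc j} i≢j → adj (i≢j ∘ cong suc) }

clique⇒K : ∀ {t} {G : Graph} {S} → CliqueOfSize G t S →
  Σ (K t G) λ c → ∀ i → vertex c i ∈ S
clique⇒K {S = S} (cl , refl) =
  clique (element S) (λ i≢j → cl _ _ (element-∈ S _) (element-∈ S _) (i≢j ∘ element-injective S)) ,
  element-∈ S

K⇒clique : ∀ {t} {G : Graph} (c : K t G) → CliqueOfSize G t (image (vertex c))
K⇒clique {G = G} c = cl , ∣image∣ (vertex c) (vertex-injective c)
  where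
  cl : Clique G (image (vertex c))
  cl u v u∈ v∈ u≢v with ∈-image⁻ (vertex c) u∈ | ∈-image⁻ (vertex c) v∈
  ... | i , refl | j , refl = adjacent c (u≢v ∘ cong (vertex c))

K⇒≤ω : ∀ {t} {G : Graph} → K t G → t ≤ ω G
K⇒≤ω {G = G} c with K⇒clique c
... | cl , eq = subst (_≤ ω G) eq (∣S∣≤maxCard (clique? G) cl)

≤ω⇒K : ∀ {t} {G : Graph} → t ≤ ω G → K t G
≤ω⇒K {G = G} t≤ω with maxCard-attained (clique? G) (λ u v u∈ → contradiction u∈ ∉⊥)
... | S , cl , eq = K-≤ t≤ω (proj₁ (clique⇒K {G = G} (cl , eq)))

ω<⇒¬K : ∀ {q} {G : Graph} → ω G < q → ¬ K q G
ω<⇒¬K {G = G} ω<q c = <⇒≱ ω<q (K⇒≤ω {G = G} c)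

¬K⇒ω< : ∀ {q} {G : Graph} → ¬ K q G → ω G < q
¬K⇒ω< {G = G} ¬c = ≰⇒> (¬c ∘ ≤ω⇒K {G = G})

-- Arrowing in terms of embedded cliques

MonochromaticK : (G : Graph) {s : ℕ} → Vec ℕ s → (V G → Fin s) → Set
MonochromaticK G a colour =
  ∃ λ i → Σ (K (lookup a i) G) λ c → ∀ x → colour (vertex c x) ≡ i

⟶ᵛ⇒mono : ∀ {G : Graph} {s} (a : Vec ℕ s) → G ⟶ᵛ a → ∀ colour → MonochromaticK G a colour
⟶ᵛ⇒mono {G} a arr colour with arr colour
... | i , S , cl , same with clique⇒K {G = G} cl
...   | c , c∈S = i , c , λ x → same _ (c∈S x)

mono⇒⟶ᵛ : ∀ {G : Graph} {s} (a : Vec ℕ s) → (∀ colour → MonochromaticK G a colour) → G ⟶ᵛ a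
mono⇒⟶ᵛ a mono colour with mono colour
... | i , c , same = i , image (vertex c) , K⇒clique c , λ v v∈ → same′ (∈-image⁻ (vertex c) v∈)
  where
  same′ : ∀ {v} → ∃ (λ x → vertex c x ≡ v) → colour v ≡ i
  same′ (x , refl) = same x

-- A colouring of `H` is pulled back along `f` and the clique found in `G` is pushed forward. This
-- covers both added edges, with `f` the identity, and isomorphisms.
⟶ᵛ-map : ∀ {G H : Graph} (f : V G → V H) → (∀ {u v} → Adj G u v → Adj H (f u) (f v)) →
  ∀ {s} (a : Vec ℕ s) → G ⟶ᵛ a → H ⟶ᵛ a
⟶ᵛ-map {G} {H} f hom a arr = mono⇒⟶ᵛ {H} a λ colour →
  let i , c , same = ⟶ᵛ⇒mono {G} a arr (colour ∘ f) in i , K-map {G = G} {H} f hom c , same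

edgeless-K : ∀ {q} {G : Graph} → (∀ {u v} → ¬ Adj G u v) → K (suc q) G → q ≡ 0
edgeless-K {zero}  ¬adj c = refl
edgeless-K {suc q} ¬adj c = contradiction (adjacent c {zero} {suc zero} λ ()) ¬adj

sum-pred-2s : ∀ n → Vec.sum (Vec.map pred (replicate n 2)) ≡ n
sum-pred-2s zero    = refl
sum-pred-2s (suc n) = cong suc (sum-pred-2s n)

sum-pred-≤1 : ∀ {n} (a : Vec ℕ n) → (∀ i → lookup a i ≤ 1) → Vec.sum (Vec.map pred a) ≡ 0
sum-pred-≤1 []            _   = refl
sum-pred-≤1 (zero  ∷ a)   a≤1 = sum-pred-≤1 a (a≤1 ∘ suc)
sum-pred-≤1 (suc x ∷ a)   a≤1 with s≤s z≤n ← a≤1 zero = sum-pred-≤1 a (a≤1 ∘ suc)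

-- Otherwise the tuple (2, …, 2) is admissible.
arrows-without-edge : ∀ {m p} {G : Graph} → 1 ≤ p → G ⟶ᵛ suc m ∣ p → ¬ K 2 G → suc m ≡ 1 ⊎ p ≡ 1
arrows-without-edge {zero}                      _ _   _   = inj₁ refl
arrows-without-edge {suc m} {suc zero}          _ _   _   = inj₂ refl
arrows-without-edge {suc m} {suc (suc p)} {G} _ arr ¬K₂ =
  contradiction (subst (λ t → K t G) (lookup-replicate i 2) c) ¬K₂
  where
  2s : Vec ℕ (suc m)
  2s = replicate (suc m) 2
  mono : MonochromaticK G 2s (const zero)
  mono = ⟶ᵛ⇒mono {G} 2s (arr 2s
    (λ i → subst (1 ≤_) (sym (lookup-replicate i 2)) (s≤s z≤n))
    (trans (ℕ.+-comm _ 1) (cong suc (sum-pred-2s (suc m))))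
    (λ i → subst (_≤ 2 + p) (sym (lookup-replicate i 2)) (s≤s (s≤s z≤n)))) (const zero)
  i = proj₁ mono
  c = proj₁ (proj₂ mono)

⟶ᵛ∣-map : ∀ {G H : Graph} (f : V G → V H) → (∀ {u v} → Adj G u v → Adj H (f u) (f v)) →
  ∀ {m p} → G ⟶ᵛ m ∣ p → H ⟶ᵛ m ∣ p
⟶ᵛ∣-map {G} {H} f hom arr a 1≤a sum a≤p = ⟶ᵛ-map {G} {H} f hom a (arr a 1≤a sum a≤p)

-- Added edges and maximality

module _ (G : Graph) {u v : V G} (e : NonEdge G u v) where

  K-avoiding-u : ∀ {t} (c : K t (G +ₑ e)) → (∀ i → vertex c i ≢ u) → K t G
  K-avoiding-u (clique c adj) ≢u = clique c λ i≢j → old (adj i≢j) (≢u _) (≢u _)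
    where
    old : ∀ {x y} → Adj (G +ₑ e) x y → x ≢ u → y ≢ u → Adj G x y
    old (inj₁ a)                _   _   = a
    old (inj₂ (inj₁ (x≡u , _))) x≢u _   = contradiction x≡u x≢u
    old (inj₂ (inj₂ (_ , y≡u))) _   y≢u = contradiction y≡u y≢u

  K-avoiding-v : ∀ {t} (c : K t (G +ₑ e)) → (∀ i → vertex c i ≢ v) → K t G
  K-avoiding-v (clique c adj) ≢v = clique c λ i≢j → old (adj i≢j) (≢v _) (≢v _)
    where
    old : ∀ {x y} → Adj (G +ₑ e) x y → x ≢ v → y ≢ v → Adj G x y
    old (inj₁ a)                _   _   = a
    old (inj₂ (inj₁ (_ , y≡v))) _   y≢v = contradiction y≡v y≢v
    old (inj₂ (inj₂ (x≡v , _))) x≢v _   = contradiction x≡v x≢v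

  new-clique-contains-u : ∀ {t} → ¬ K t G → (c : K t (G +ₑ e)) → ∃ λ i → vertex c i ≡ u
  new-clique-contains-u ¬KG c with any? (λ i → vertex c i Fin.≟ u)
  ... | yes hit = hit
  ... | no  ¬hit = contradiction (K-avoiding-u c λ i eq → ¬hit (i , eq)) ¬KG

  new-clique-contains-v : ∀ {t} → ¬ K t G → (c : K t (G +ₑ e)) → ∃ λ i → vertex c i ≡ v
  new-clique-contains-v ¬KG c with any? (λ i → vertex c i Fin.≟ v)
  ... | yes hit = hit
  ... | no  ¬hit = contradiction (K-avoiding-v c λ i eq → ¬hit (i , eq)) ¬KG

  -- Dropping one end of the added edge leaves only old edges, so an added edge raises the clique
  -- number by at most one.
  K-without-edge : ∀ {t} → K (suc t) (G +ₑ e) → K t G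
  K-without-edge c with any? (λ i → vertex c i Fin.≟ u)
  ... | yes (i , ci≡u) = K-avoiding-u (K-remove {G = G +ₑ e} c i)
          λ j eq → Fin.punchInᵢ≢i i j (vertex-injective c (trans eq (sym ci≡u)))
  -- All edges of the clique are old already, so any vertex may be dropped.
  ... | no  ¬hit = K-avoiding-u (K-remove {G = G +ₑ e} c zero) λ j eq → ¬hit (_ , eq)

Saturated : ℕ → Graph → Set
Saturated q G = ∀ {u v} (e : NonEdge G u v) → K q (G +ₑ e)

module _ {m p q n : ℕ} where

  Maximal⇒¬K : ∀ {G : Graph} → Maximal m p q n G → ¬ K q G
  Maximal⇒¬K {G} (((_ , ω<q) , _) , _) = ω<⇒¬K {G = G} ω<q

  -- Arrowing survives the added edge, so only the bound on `ω` can fail. Comparing `q` with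
  -- `ω (G +ₑ e)` produces the clique itself from this negative information.
  Maximal⇒Saturated : ∀ {G : Graph} → Maximal m p q n G → Saturated q G
  Maximal⇒Saturated {G} (((arr , _) , ord) , not-ℋ̃) e with q ≤? ω (G +ₑ e)
  ... | yes q≤ω = ≤ω⇒K {G = G +ₑ e} q≤ω
  ... | no  q≰ω = ⊥-elim (not-ℋ̃ e
          ((⟶ᵛ∣-map {G} {G +ₑ e} (λ x → x) inj₁ {m} {p} arr , ≰⇒> q≰ω) , ord))

  Maximal⇒ω≡q : ∀ {G : Graph} → Maximal m p q n G → ∀ {u v} (e : NonEdge G u v) → ω (G +ₑ e) ≡ q
  Maximal⇒ω≡q {G} mx e = ≤-antisym
    (ℕ.≮⇒≥ λ q<ω → Maximal⇒¬K mx (K-without-edge G e (≤ω⇒K {G = G +ₑ e} q<ω)))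
    (K⇒≤ω {G = G +ₑ e} (Maximal⇒Saturated mx e))

  Maximal-≅ : ∀ {G H : Graph} → G ≅ H → Maximal m p q n G → Maximal m p q n H
  Maximal-≅ {G} {H} iso mx@(((arr , ω<q) , ord) , _) =
    ((⟶ᵛ∣-map {G} {H} to hom {m} {p} arr
    , ¬K⇒ω< {G = H} (ω<⇒¬K {G = G} ω<q ∘ K-map {G = H} {G} from hom⁻¹))
    , trans (sym (↔⇒≡ bijection)) ord
    ) , λ { {u} {v} e@(u≢v , ¬uv) ((_ , ω<) , _) →
      let e′ = (λ eq → u≢v (trans (sym (to-from u)) (trans (cong to eq) (to-from v)))) ,
               (λ a → ¬uv (subst₂ (Adj H) (to-from u) (to-from v) (hom a)))
      in ω<⇒¬K {G = H +ₑ e} ω< (K-map {G = G +ₑ e′} {H +ₑ e} to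
           (λ { (inj₁ a) → inj₁ (hom a)
              ; (inj₂ (inj₁ (refl , refl))) → inj₂ (inj₁ (to-from u , to-from v))
              ; (inj₂ (inj₂ (refl , refl))) → inj₂ (inj₂ (to-from v , to-from u)) })
           (Maximal⇒Saturated mx e′)) }
    where
    open _≅_ iso
    open Inverse bijection using (to; from) renaming (strictlyInverseˡ to to-from)
    hom : ∀ {u v} → Adj G u v → Adj H (to u) (to v)
    hom = Equivalence.to (preserves _ _)
    hom⁻¹ : ∀ {u v} → Adj H u v → Adj G (from u) (from v)
    hom⁻¹ a = Equivalence.from (preserves _ _)
      (subst₂ (Adj H) (sym (to-from _)) (sym (to-from _)) a)

-- Splitting off an independent set

module Extension (H : Graph) (k : ℕ) (N : Fin k → Subset (order H)) where

  G : Graph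
  G = extend H k N

  left : V H → V G
  left u = u ↑ˡ k

  right : Fin k → V G
  right j = order H ↑ʳ j

  -- A view of the vertices that replaces case distinctions on `splitAt`, through which `extend`
  -- defines adjacency.
  data Side : V G → Set where
    isLeft  : ∀ u → Side (left u)
    isRight : ∀ j → Side (right j)

  side : ∀ x → Side x
  side x with splitAt (order H) x | join-splitAt (order H) k x
  ... | inj₁ u | refl = isLeft u
  ... | inj₂ j | refl = isRight j

  left≢right : ∀ {u j} → left u ≢ right j
  left≢right {u} {j} eq with trans (sym (splitAt-↑ˡ (order H) u k))
                       (trans (cong (splitAt (order H)) eq) (splitAt-↑ʳ (order H) k j))
  ... | ()

  adj-ll : ∀ u v → Adj G (left u) (left v) ⇔ Adj H u v
  adj-ll u v rewrite splitAt-↑ˡ (order H) u k | splitAt-↑ˡ (order H) v k = mk⇔ (λ a → a) (λ a → a)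

  adj-lr : ∀ u j → Adj G (left u) (right j) ⇔ u ∈ N j
  adj-lr u j rewrite splitAt-↑ˡ (order H) u k | splitAt-↑ʳ (order H) k j = mk⇔ (λ a → a) (λ a → a)

  ¬adj-rr : ∀ i j → ¬ Adj G (right i) (right j)
  ¬adj-rr i j rewrite splitAt-↑ʳ (order H) k i | splitAt-↑ʳ (order H) k j = λ ()

  adj-right : ∀ {j x} → Adj G (right j) x → ∃ λ u → x ≡ left u
  adj-right {j} {x} a with side x
  ... | isLeft u  = u , refl
  ... | isRight i = contradiction a (¬adj-rr j i)

  α≥k : α G ≥ k
  α≥k = subst (_≤ α G) (∣image∣ right (Fin.↑ʳ-injective (order H) _ _))
          (∣S∣≤maxCard (independent? G) indep)
    where
    indep : Independent G (image right)
    indep u v u∈ v∈ with ∈-image⁻ right u∈ | ∈-image⁻ right v∈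
    ... | i , refl | j , refl = ¬adj-rr i j

-- An isomorphism of `G` with `extend H k N`, stated on a disjoint sum to keep index arithmetic out.
-- Adjacency from a new vertex to the core follows from `lr` by symmetry.
record Decomposition (G H : Graph) {k : ℕ} (N : Fin k → Subset (order H)) : Set where
  field
    bij : V G ↔ (V H ⊎ Fin k)
  open Inverse bij public
  field
    ll : ∀ u v → Adj G (from (inj₁ u)) (from (inj₁ v)) ⇔ Adj H u v
    lr : ∀ u j → Adj G (from (inj₁ u)) (from (inj₂ j)) ⇔ u ∈ N j
    rr : ∀ i j → ¬ Adj G (from (inj₂ i)) (from (inj₂ j))

Decomposition⇒≅ : ∀ {G H : Graph} {k} {N : Fin k → Subset (order H)} →
  Decomposition G H N → G ≅ extend H k N
Decomposition⇒≅ {G} {H} {k} {N} D = record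
  { bijection = mk↔ₛ′ (join (order H) k ∘ to) (from ∘ splitAt (order H))
      (λ x → trans (cong (join (order H) k) (strictlyInverseˡ _)) (join-splitAt (order H) k x))
      (λ x → trans (cong from (splitAt-join (order H) k _)) (strictlyInverseʳ x))
  ; preserves = λ u v → subst₂ (λ x y → Adj G x y ⇔ Adj E.G (join (order H) k (to u)) (join (order H) k (to v)))
      (strictlyInverseʳ u) (strictlyInverseʳ v) (preserves′ (to u) (to v))
  }
  where
  open Decomposition D
  module E = Extension H k N
  _⨾_ : ∀ {A B C : Set} → A ⇔ B → C ⇔ B → A ⇔ C
  f ⨾ g = mk⇔ (Equivalence.from g ∘ Equivalence.to f) (Equivalence.from f ∘ Equivalence.to g)
  preserves′ : ∀ x y → Adj G (from x) (from y) ⇔ Adj E.G (join (order H) k x) (join (order H) k y)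
  preserves′ (inj₁ u) (inj₁ v) = ll u v ⨾ E.adj-ll u v
  preserves′ (inj₁ u) (inj₂ j) = lr u j ⨾ E.adj-lr u j
  preserves′ (inj₂ i) (inj₁ v) = mk⇔
    (symm E.G {E.left v} {E.right i} ∘ Equivalence.to (preserves′ (inj₁ v) (inj₂ i)) ∘ symm G)
    (symm G ∘ Equivalence.from (preserves′ (inj₁ v) (inj₂ i)) ∘ symm E.G {E.right i} {E.left v})
  preserves′ (inj₂ i) (inj₂ j) =
    mk⇔ (λ a → contradiction a (rr i j)) (λ a → contradiction a (E.¬adj-rr i j))

-- Only the new vertices are relabelled; the core is untouched. This lets their neighbourhoods be
-- listed in sorted order.
permute : ∀ {G H : Graph} {k} {N N′ : Fin k → Subset (order H)} →
  Decomposition G H N → (π : Permutation′ k) → (∀ j → N′ j ≡ N (π ⟨$⟩ʳ j)) → Decomposition G H N′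
permute {N′ = N′} D π N′≡N∘π = record
  { bij = mk↔ₛ′ (Sum.map₂ π.from ∘ to) (from ∘ Sum.map₂ π.to)
      (λ { (inj₁ u) → cong (Sum.map₂ π.from) (strictlyInverseˡ (inj₁ u))
         ; (inj₂ j) → trans (cong (Sum.map₂ π.from) (strictlyInverseˡ (inj₂ (π.to j))))
                            (cong inj₂ (π.strictlyInverseʳ j)) })
      (λ x → trans (cong from (undo (to x))) (strictlyInverseʳ x))
  ; ll = ll
  ; lr = λ u j → subst (λ S → _ ⇔ u ∈ S) (sym (N′≡N∘π j)) (lr u (π.to j))
  ; rr = λ i j → rr (π.to i) (π.to j)
  }
  where
  open Decomposition D
  module π = Inverse π
  undo : ∀ x → Sum.map₂ π.to (Sum.map₂ π.from x) ≡ x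
  undo (inj₁ u) = refl
  undo (inj₂ j) = cong inj₂ (π.strictlyInverseˡ j)

∈-tabulate-does : ∀ {n} {P : Pred (Fin n) 0ℓ} (P? : U.Decidable P) x →
  P x ⇔ x ∈ Vec.tabulate (λ y → does (P? y))
∈-tabulate-does {P = P} P? x = mk⇔
  (λ Px → lookup⇒[]= x _ (trans (lookup∘tabulate _ x) (dec-true (P? x) Px)))
  (λ x∈ → holds (trans (sym (lookup∘tabulate _ x)) ([]=⇒lookup x∈)))
  where
  holds : does (P? x) ≡ true → P x
  holds eq with P? x
  ... | yes Px = Px

decompose : ∀ {k} (G : Graph) → α G ≥ k →
  Σ Graph λ H → Σ (Fin k → Subset (order H)) (Decomposition G H)
decompose {k} G α≥k with maxCard-attained (independent? G) (λ u v u∈ → contradiction u∈ ∉⊥)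
-- The largest independent set `S` may have more than `k` elements; the image of its first `k`
-- elements has exactly `k`.
... | S , indep , eq = along (image f) (∣image∣ f f-injective) λ u∈ v∈ → indep _ _ (image⊆S u∈) (image⊆S v∈)
  where
  k≤∣S∣ : k ≤ ∣ S ∣
  k≤∣S∣ = ≤-trans α≥k (≤-reflexive (sym eq))
  f : Fin k → V G
  f i = element S (inject≤ i k≤∣S∣)
  f-injective : Injective _≡_ _≡_ f
  f-injective = Fin.inject≤-injective k≤∣S∣ k≤∣S∣ _ _ ∘ element-injective S
  image⊆S : image f ⊆ S
  image⊆S = image-⊆ f λ i → element-∈ S (inject≤ i k≤∣S∣)

  -- A fresh `k` is bound here so that the size equation can be matched with `refl`.
  along : ∀ (T : Subset (order G)) {k} → ∣ T ∣ ≡ k → (∀ {u v} → u ∈ T → v ∈ T → ¬ Adj G u v) →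
    Σ Graph λ H → Σ (Fin k → Subset (order H)) (Decomposition G H)
  along T refl ind = H , N , record
    { bij = partition T
    ; ll  = λ u v → mk⇔ (λ a → a) (λ a → a)
    ; lr  = λ u j → ∈-tabulate-does (λ u → adj? G (element (∁ T) u) (element T j)) u
    ; rr  = λ i j → ind (element-∈ T i) (element-∈ T j)
    }
    where
    H : Graph
    H = record
      { order  = ∣ ∁ T ∣
      ; Adj    = λ u v → Adj G (element (∁ T) u) (element (∁ T) v)
      ; adj?   = λ u v → adj? G (element (∁ T) u) (element (∁ T) v)
      ; symm   = symm G
      ; irrefl = λ { refl → irrefl G refl }
      }
    N : Fin ∣ T ∣ → Subset (order H)
    N j = Vec.tabulate λ u → does (adj? G (element (∁ T) u) (element T j))

-- The core of a maximal extension

-- Here `m` and `q` stand for the theorem's m - 1 and q - 2, so that the truncated subtractions in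
-- `𝒜` and `ℳ` compute.
module _ {m p q n k : ℕ} (H : Graph) (N : Fin k → Subset (order H))
         (mx : Maximal (suc m) p (2 + q) n (extend H k N)) where
  open Extension H k N

  private
    ¬KG : ¬ K (2 + q) G
    ¬KG = Maximal⇒¬K mx

    order≡ : order H + k ≡ n
    order≡ = proj₂ (proj₁ mx)

    K-left : ∀ {t} → K t H → K t G
    K-left = K-map {G = H} {G} left λ a → Equivalence.from (adj-ll _ _) a

    K-restrict : ∀ {t} (c : K t G) → (∀ i → ∃ λ u → vertex c i ≡ left u) →
      Σ (K t H) λ d → ∀ i → vertex c i ≡ left (vertex d i)
    K-restrict c lefts =
      clique (proj₁ ∘ lefts)
        (λ i≢j → Equivalence.to (adj-ll _ _)
          (subst₂ (Adj G) (proj₂ (lefts _)) (proj₂ (lefts _)) (adjacent c i≢j))) ,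
      proj₂ ∘ lefts

  -- A `suc q`-clique among the neighbours of a new vertex would form a `2 + q`-clique with that
  -- vertex.
  neighbourhood-KFree : ∀ j → KFree (suc q) H (N j)
  neighbourhood-KFree j (T , T⊆N , cl) with clique⇒K {G = H} cl
  ... | c , c∈T = ¬KG (K-cons {G = G} (right j) (K-left c)
    λ i → symm G {left (vertex c i)} {right j} (Equivalence.from (adj-lr _ j) (T⊆N (c∈T i))))

  -- For w outside N j, the q-clique created by the edge from w to the j-th
  -- new vertex is that vertex together with a (q-1)-clique in N j ∪ {w}.
  neighbourhood-maximal : ∀ j → MaximalKFree (suc q) H (N j)
  neighbourhood-maximal j = neighbourhood-KFree j ,
    λ (S , (N⊆S , w , w∈S , w∉N) , free) → 
      let e = left≢right , w∉N ∘ Equivalence.to (adj-lr w j)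
      in free (clique-within N⊆S w∈S e (Maximal⇒Saturated mx e))
    where
    module _ {S : Subset (order H)} {w : V H} (N⊆S : N j ⊆ S) (w∈S : w ∈ S)
             (e : NonEdge G (left w) (right j)) (c : K (2 + q) (G +ₑ e)) where
      i = proj₁ (new-clique-contains-v G e ¬KG c)

      ci≡j : vertex c i ≡ right j
      ci≡j = proj₂ (new-clique-contains-v G e ¬KG c)

      neighbour : ∀ {x} → Adj (G +ₑ e) (right j) x → ∃ λ u → x ≡ left u × u ∈ S
      neighbour (inj₁ a) with adj-right a
      ... | u , refl = u , refl , N⊆S (Equivalence.to (adj-lr u j) (symm G {right j} {left u} a))
      neighbour (inj₂ (inj₁ (eq , _))) = contradiction (sym eq) left≢right
      neighbour (inj₂ (inj₂ (_ , eq))) = w , eq , w∈S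

      rest : ∀ z → ∃ λ u → vertex c (punchIn i z) ≡ left u × u ∈ S
      rest z = neighbour (subst (λ x → Adj (G +ₑ e) x (vertex c (punchIn i z))) ci≡j
                 (adjacent c (Fin.punchInᵢ≢i i z ∘ sym)))

      -- One end of the added edge is a new vertex, so between core vertices all edges are old.
      old : ∀ {u v} → Adj (G +ₑ e) (left u) (left v) → Adj H u v
      old (inj₁ a)                = Equivalence.to (adj-ll _ _) a
      old (inj₂ (inj₁ (_ , eq))) = contradiction eq left≢right
      old (inj₂ (inj₂ (eq , _))) = contradiction eq left≢right

      d : K (suc q) H
      d = clique (proj₁ ∘ rest) λ x≢y → old
            (subst₂ (Adj (G +ₑ e)) (proj₁ (proj₂ (rest _))) (proj₁ (proj₂ (rest _)))
              (adjacent (K-remove {G = G +ₑ e} c i) x≢y))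

      clique-within : ∃ λ T → T ⊆ S × CliqueOfSize H (suc q) T
      clique-within = image (vertex d) , image-⊆ (vertex d) (proj₂ ∘ proj₂ ∘ rest) , K⇒clique d

  -- Colour the new vertices with one further colour, which is allotted a
  -- 2-clique and cannot contain one.
  core-arrows-2≤p : 2 ≤ p → H ⟶ᵛ m ∣ p
  core-arrows-2≤p 2≤p {s} a 1≤a sum a≤p = mono⇒⟶ᵛ {H} a λ colour →
    restrict colour (⟶ᵛ⇒mono {G} (2 ∷ a) G⟶2∷a (colour′ colour))
    where
    G⟶2∷a : G ⟶ᵛ 2 ∷ a
    G⟶2∷a = proj₁ (proj₁ (proj₁ mx)) (2 ∷ a)
      -- The entry 2 adds one to the sum, which turns a tuple for `m` into one for `suc m`.
      (λ { zero → s≤s z≤n ; (suc i) → 1≤a i }) (cong suc sum)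
      (λ { zero → 2≤p ; (suc i) → a≤p i })

    module _ (colour : V H → Fin (suc s)) where
      colour′ : V G → Fin (suc (suc s))
      colour′ x = [ suc ∘ colour , const zero ] (splitAt (order H) x)

      colour-left : ∀ u → colour′ (left u) ≡ suc (colour u)
      colour-left u = cong [ suc ∘ colour , const zero ] (splitAt-↑ˡ (order H) u k)

      colour-right : ∀ j → colour′ (right j) ≡ zero
      colour-right j = cong [ suc ∘ colour , const zero ] (splitAt-↑ʳ (order H) k j)

      zero⇒right : ∀ {x} → colour′ x ≡ zero → ∃ λ j → x ≡ right j
      zero⇒right {x} eq with side x
      ... | isLeft u  = contradiction (trans (sym (colour-left u)) eq) λ ()
      ... | isRight j = j , refl

      suc⇒left : ∀ {x i} → colour′ x ≡ suc i → ∃ λ u → x ≡ left u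
      suc⇒left {x} eq with side x
      ... | isLeft u  = u , refl
      ... | isRight j = contradiction (trans (sym (colour-right j)) eq) λ ()

      restrict : MonochromaticK G (2 ∷ a) colour′ → MonochromaticK H a colour
      restrict (zero , c , same) with zero⇒right (same zero) | zero⇒right (same (suc zero))
      ... | i , eq | j , eq′ = contradiction
              (subst₂ (Adj G) eq eq′ (adjacent c λ ())) (¬adj-rr i j)
      restrict (suc i , c , same) with K-restrict c (λ x → suc⇒left (same x))
      ... | d , eq = i , d , λ x → Fin.suc-injective
              (trans (sym (colour-left _)) (trans (cong colour′ (sym (eq x))) (same x)))

  module _ (1≤p : 1 ≤ p) (¬exc : ¬ Exceptional (suc m) p (2 + q) n k) where

    private
      G-edgeless : ¬ V H → ∀ {x y} → ¬ Adj G x y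
      G-edgeless ¬VH {x} {y} with side x | side y
      ... | isLeft u  | _         = λ _ → ¬VH u
      ... | isRight i | isLeft v  = λ _ → ¬VH v
      ... | isRight i | isRight j = ¬adj-rr i j

      -- With an empty core `G` is edgeless, so an added edge creates a clique of at most two
      -- vertices, while saturation demands `2 + q`. The outcomes are the two alternatives in
      -- `null`.
      q≡0-or-singleton : ¬ V H → 1 ≤ n → q ≡ 0 ⊎ n ≡ 1
      q≡0-or-singleton ¬VH 1≤n with singleton-or-two-distinct (subst (1 ≤_) (sym order≡) 1≤n)
      ... | inj₁ order≡1       = inj₂ (trans (sym order≡) order≡1)
      ... | inj₂ (u , v , u≢v) =
        let e = u≢v , G-edgeless ¬VH
        in inj₁ (edgeless-K {G = G} (G-edgeless ¬VH) (K-without-edge G e (Maximal⇒Saturated mx e)))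

    -- An empty core means n = k, which here is the excluded case `null`.
    core-inhabited : m ≡ 1 → p ≡ 1 → 1 ≤ n → V H
    core-inhabited m≡1 p≡1 1≤n with empty-or-inhabited (order H)
    ... | inj₂ u = u
    ... | inj₁ order≡0 = contradiction
      (null (cong suc m≡1) p≡1 (trans (sym order≡) (cong (_+ k) order≡0))
        (Sum.map (cong (2 +_)) (_, s≤s (s≤s z≤n))
          (q≡0-or-singleton (λ u → contradiction (subst Fin order≡0 u) λ ()) 1≤n)))
      ¬exc

    core-arrows : 1 ≤ n → H ⟶ᵛ m ∣ p
    core-arrows 1≤n with ℕ.m≤n⇒m<n∨m≡n 1≤p
    ... | inj₁ 2≤p = core-arrows-2≤p 2≤p
    -- For p = 1 a colour class allotted a 2-clique is inadmissible. All entries are at most 1, so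
    -- the sum forces m = 1, and any vertex of the core is the monochromatic clique.
    ... | inj₂ 1≡p = λ a 1≤a sum a≤p →
      let a≤1 = λ i → ≤-trans (a≤p i) (≤-reflexive (sym 1≡p))
          u   = core-inhabited (trans (sym sum) (cong (_+ 1) (sum-pred-≤1 a a≤1))) (sym 1≡p) 1≤n
      in mono⇒⟶ᵛ {H} a λ colour →
           colour u , K-≤ {G = H} (a≤1 (colour u)) (K-single {H} u) , λ _ → refl

    -- With q = 0 the graph `G` would have no edge, and two distinct core vertices give `2 + k ≤ n`:
    -- this is the excluded case `edgeless`.
    q≢0 : ∀ {u v : V H} → u ≢ v → q ≢ 0
    q≢0 u≢v q≡0 = ¬exc (edgeless (cong (2 +_) q≡0)
      (arrows-without-edge {G = G} 1≤p (proj₁ (proj₁ (proj₁ mx))) (subst (λ q → ¬ K (2 + q) G) q≡0 ¬KG))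
      (≤-trans (ℕ.+-monoˡ-≤ k (Fin-≢⇒2≤ u≢v)) (≤-reflexive order≡)))

    -- The q-clique created in G contains at most one new vertex; drop that
    -- one, or any vertex off the edge e if there is none.
    core-PlusK : PlusK (suc q) H
    core-PlusK {u} {v} e@(u≢v , ¬uv) = new-clique (Maximal⇒Saturated mx e′)
      where
      e′ : NonEdge G (left u) (left v)
      e′ = u≢v ∘ Fin.↑ˡ-injective k u v , ¬uv ∘ Equivalence.to (adj-ll u v)

      module _ (c : K (2 + q) (G +ₑ e′)) where
        contains-u = new-clique-contains-u G e′ ¬KG c
        contains-v = new-clique-contains-v G e′ ¬KG c
        i = proj₁ contains-u
        j = proj₁ contains-v
        ci≡u = proj₂ contains-u
        cj≡v = proj₂ contains-v

        neighbour : ∀ {a x} → Adj (G +ₑ e′) (right a) x → ∃ λ w → x ≡ left w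
        neighbour (inj₁ a)                = adj-right a
        neighbour (inj₂ (inj₁ (eq , _))) = contradiction (sym eq) left≢right
        neighbour (inj₂ (inj₂ (eq , _))) = contradiction (sym eq) left≢right

        removable : ∃ λ x → i ≢ x × j ≢ x × (∀ z → ∃ λ w → vertex c (punchIn x z) ≡ left w)
        removable with any? (λ x → any? (λ a → vertex c x Fin.≟ right a))
        -- The added edge lies inside the core, so a new vertex has core neighbours only and is the
        -- sole new vertex of the clique.
        ... | yes (x , a , eq) = x ,
          (λ i≡x → left≢right (trans (sym ci≡u) (trans (cong (vertex c) i≡x) eq))) ,
          (λ j≡x → left≢right (trans (sym cj≡v) (trans (cong (vertex c) j≡x) eq))) ,
          λ z → neighbour (subst (λ y → Adj (G +ₑ e′) y (vertex c (punchIn x z))) eq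
                  (adjacent c (Fin.punchInᵢ≢i x z ∘ sym)))
        ... | no none with other-than-two (q≢0 u≢v) i j
        ...   | x , i≢x , j≢x = x , i≢x , j≢x , λ z → isLeft-of (punchIn x z)
          where
          isLeft-of : ∀ y → ∃ λ w → vertex c y ≡ left w
          isLeft-of y with vertex c y in eq
          ... | cy with side cy
          ...   | isLeft w  = w , refl
          ...   | isRight a = contradiction (y , a , eq) none

        x = proj₁ removable
        i≢x = proj₁ (proj₂ removable)
        j≢x = proj₁ (proj₂ (proj₂ removable))
        lefts = proj₂ (proj₂ (proj₂ removable))

        pull : ∀ {w w′} → Adj (G +ₑ e′) (left w) (left w′) → Adj (H +ₑ e) w w′
        pull (inj₁ a) = inj₁ (Equivalence.to (adj-ll _ _) a)
        pull (inj₂ (inj₁ (p , r))) = inj₂ (inj₁ (Fin.↑ˡ-injective k _ _ p , Fin.↑ˡ-injective k _ _ r))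
        pull (inj₂ (inj₂ (p , r))) = inj₂ (inj₂ (Fin.↑ˡ-injective k _ _ p , Fin.↑ˡ-injective k _ _ r))

        d : K (suc q) (H +ₑ e)
        d = clique (proj₁ ∘ lefts) λ y≢z → pull
              (subst₂ (Adj (G +ₑ e′)) (proj₂ (lefts _)) (proj₂ (lefts _))
                (adjacent (K-remove {G = G +ₑ e′} c x) y≢z))

        hit : ∀ {y w} → y ≢ x → vertex c y ≡ left w → w ∈ image (vertex d)
        hit {y} {w} y≢x cy≡w = subst (_∈ image (vertex d))
          (Fin.↑ˡ-injective k _ _ (trans (sym (proj₂ (lefts z)))
            (trans (cong (vertex c) (Fin.punchIn-punchOut x≢y)) cy≡w)))
          (∈-image⁺ (vertex d) z)
          where
          x≢y = y≢x ∘ sym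
          z = punchOut x≢y

        new-clique : ∃ λ S → CliqueOfSize (H +ₑ e) (suc q) S × ¬ CliqueOfSize H (suc q) S
        new-clique = image (vertex d) , K⇒clique d ,
          -- Both ends of `e` survive the removal of `x`, and they are not adjacent in `H`.
          λ (cl , _) → ¬uv (cl u v (hit i≢x ci≡u) (hit j≢x cj≡v) u≢v)

    core∈𝒜 : 1 ≤ n → 𝒜 (suc m) p (2 + q) n k H
    core∈𝒜 1≤n =
      ((core-arrows 1≤n , ¬K⇒ω< {G = H} (¬KG ∘ K-left)) ,
       trans (sym (ℕ.m+n∸n≡m (order H) k)) (cong (_∸ k) order≡)) ,
      core-PlusK

-- The two inclusions

ℬ⊆Maximal : ∀ {m p q n k} {G : Graph} → ℬ m p q n k G → Maximal m p q n G × α G ≥ k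
ℬ⊆Maximal {q = q} (obtain H _ i _ , ω≡q , mem) =
  (mem , λ e ((_ , ω<q) , _) → ℕ.<-irrefl (ω≡q e) ω<q) ,
  Extension.α≥k H _ (List.lookup (ℳ q H) ∘ i)

∈-ℳ : ∀ q {H : Graph} {S} → MaximalKFree (q ∸ 1) H S → S ∈ₗ ℳ q H
∈-ℳ q {H} {S} = ∈-filter⁺ (maximalKFree? (q ∸ 1) H) (∈-subsets S)

-- Two extensions of one core occur: with the neighbourhoods `N` as the decomposition yields them,
-- and with `N′` in the order of `ℳ`. Maximality is carried to the first to analyse the core and to
-- the second to obtain membership in `ℬ`.
Maximal⊆ℬ : ∀ {m p q n k} (G : Graph) → 1 ≤ p → 1 ≤ n →
  ¬ Exceptional (suc m) p (2 + q) n k → Maximal (suc m) p (2 + q) n G → α G ≥ k →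
  Σ Graph λ G′ → ℬ (suc m) p (2 + q) n k G′ × G ≅ G′
Maximal⊆ℬ {m} {p} {q} {n} {k} G 1≤p 1≤n ¬exc mx α≥k with decompose G α≥k
... | H , N , D = extend H k N′ ,
  (obtain H (core∈𝒜 H N mx₀ 1≤p ¬exc 1≤n) (λ j → index (π ⟨$⟩ʳ j)) sorted ,
   Maximal⇒ω≡q {suc m} {p} {2 + q} {n} {extend H k N′} mx′ , proj₁ mx′) ,
  iso
  where
  mx₀ : Maximal (suc m) p (2 + q) n (extend H k N)
  mx₀ = Maximal-≅ (Decomposition⇒≅ D) mx

  N∈ℳ : ∀ j → N j ∈ₗ ℳ (2 + q) H
  N∈ℳ j = ∈-ℳ (2 + q) {H} (neighbourhood-maximal H N mx₀ j)

  index : Fin k → Fin (length (ℳ (2 + q) H))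
  index j = Any.index (N∈ℳ j)

  π = proj₁ (sorting-permutation index)
  sorted = λ {i} {j} → proj₂ (sorting-permutation index) {i} {j}

  N′ : Fin k → Subset (order H)
  N′ = List.lookup (ℳ (2 + q) H) ∘ λ j → index (π ⟨$⟩ʳ j)

  iso : G ≅ extend H k N′
  iso = Decomposition⇒≅ (permute D π λ j → sym (lookup-index (N∈ℳ (π ⟨$⟩ʳ j))))

  mx′ : Maximal (suc m) p (2 + q) n (extend H k N′)
  mx′ = Maximal-≅ iso mx

theorem3p3 : (m p q n k : ℕ) → m ≥ 1 → p ≥ 1 → q ≥ 1 → n ≥ 1 → k ≥ 1 →
    ¬ Exceptional m p q n k →
    ℬ m p q n k ≐ᴵ (λ G → Maximal m p q n G × α G ≥ k)
theorem3p3 (suc m) p q n k _ 1≤p 1≤q 1≤n _ ¬exc =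
  (λ G b → G , ℬ⊆Maximal b , ≅-refl) , λ G (mx , α≥k) → backward q 1≤q ¬exc G mx α≥k
  where
  ≅-refl : ∀ {G : Graph} → G ≅ G
  ≅-refl = record { bijection = id ; preserves = λ u v → mk⇔ (λ a → a) (λ a → a) }

  backward : ∀ q → 1 ≤ q → ¬ Exceptional (suc m) p q n k →
    ∀ G → Maximal (suc m) p q n G → α G ≥ k → Σ Graph λ G′ → ℬ (suc m) p q n k G′ × G ≅ G′
  -- For q = 1 no vertex is allowed, but n ≥ 1 provides one, so there is no maximal graph.
  backward (suc zero) _ _ G mx _ = contradiction
    (K-single {G} (Fin.fromℕ< (subst (1 ≤_) (sym (proj₂ (proj₁ mx))) 1≤n))) (Maximal⇒¬K mx)
  backward (suc (suc q)) _ ¬exc G mx α≥k = Maximal⊆ℬ G 1≤p 1≤n ¬exc mx α≥k
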